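{- Let $\Gamma=(\Gamma^\alpha)_{\alpha\in\{0,1\}^k}$ be a vector of complex numbers indexed by $\{0,1\}^k$ such that for all $\alpha,\beta\in\{0,1\}^k$, writing $p_1<\cdots<p_l$ for the positions where $\alpha$ and $\beta$ differ, \[ \sum_{i=1}^{l}(-1)^{i}\,\Gamma^{\alpha\oplus e_{p_i}}\,\Gamma^{\beta\oplus e_{p_i}}=0 . \] Then $\Gamma$ satisfies the Parity Condition: either $\Gamma^\alpha=0$ for all $\alpha$ of odd Hamming weight, or $\Gamma^\alpha=0$ for all $\alpha$ of even Hamming weight.
   Context: $\oplus$ denotes bitwise XOR and $e_j\in\{0,1\}^k$ is the string with a $1$ in position $j$ and $0$ elsewhere. -}

module Defs where

open import Level using (0ℓ)
open import Algebra.Bundles.Raw using (RawRing)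
open import Algebra.Definitions.RawSemiring using (sum; _^_)
open import Data.Bool using (Bool; true; false; _xor_)
import Data.Bool as Bool
open import Data.Fin using (Fin; toℕ)
open import Data.List as List using (List; allFin; filter)
open import Data.Nat as ℕ using (ℕ; suc; _⊔_)
open import Data.Nat.Divisibility using (_∣_)
import Data.Nat.Properties as ℕₚ
open import Data.Product using (∃-syntax; _×_; _,_; proj₁; proj₂)
open import Data.Rational
  using (ℚ; 0ℚ; 1ℚ; ½; ∣_∣; Positive; positive; NonZero)
import Data.Rational as ℚ
import Data.Rational.Properties as ℚₚ
open ℚₚ using (positive⁻¹)
open import Data.Rational.Solver using (module +-*-Solver)
open import Data.Sum using (_⊎_)
open import Data.Vec using (Vec; lookup; replicate; zipWith; count; _[_]≔_)
open import Relation.Binary.PropositionalEquality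
open import Relation.Nullary using (¬_; ¬?)

-- The real numbers are Cauchy sequences of rationals with pointwise
-- operations, compared up to sequences tending to 0.

Cauchy : (ℕ → ℚ) → Set
Cauchy s = ∀ ε → 0ℚ ℚ.< ε →
  ∃[ N ] (∀ m n → N ℕ.≤ m → N ℕ.≤ n → ∣ s m ℚ.- s n ∣ ℚ.< ε)

record ℝ : Set where
  constructor mkℝ
  field
    seq    : ℕ → ℚ
    cauchy : Cauchy seq

open ℝ public

infix 4 _≈ᵣ_

_≈ᵣ_ : ℝ → ℝ → Set
x ≈ᵣ y = ∀ ε → 0ℚ ℚ.< ε →
  ∃[ N ] (∀ n → N ℕ.≤ n → ∣ seq x n ℚ.- seq y n ∣ ℚ.< ε)

module _ where
  open +-*-Solver

  private
    ½-pos : ∀ {ε} → 0ℚ ℚ.< ε → 0ℚ ℚ.< ½ ℚ.* ε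
    ½-pos {ε} 0<ε = positive⁻¹ _ {{ℚₚ.pos*pos⇒pos ½ ε {{positive 0<ε}}}}

    ½+½ : ∀ ε → ½ ℚ.* ε ℚ.+ ½ ℚ.* ε ≡ ε
    ½+½ = solve 1 (λ e → con ½ :* e :+ con ½ :* e := e) refl

    sub-add : ∀ a b c d →
      (a ℚ.+ b) ℚ.- (c ℚ.+ d) ≡ (a ℚ.- c) ℚ.+ (b ℚ.- d)
    sub-add = solve 4
      (λ a b c d → (a :+ b) :- (c :+ d) := (a :- c) :+ (b :- d)) refl

    sub-neg : ∀ a b → (ℚ.- a) ℚ.- (ℚ.- b) ≡ ℚ.- (a ℚ.- b)
    sub-neg = solve 2 (λ a b → (:- a) :- (:- b) := :- (a :- b)) refl

    sub-mul : ∀ a b c d →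
      a ℚ.* b ℚ.- c ℚ.* d ≡ a ℚ.* (b ℚ.- d) ℚ.+ d ℚ.* (a ℚ.- c)
    sub-mul = solve 4
      (λ a b c d → a :* b :- c :* d := a :* (b :- d) :+ d :* (a :- c)) refl

    add-sub : ∀ a b → (a ℚ.- b) ℚ.+ b ≡ a
    add-sub a b = begin
      (a ℚ.- b) ℚ.+ b      ≡⟨ ℚₚ.+-assoc a (ℚ.- b) b ⟩
      a ℚ.+ (ℚ.- b ℚ.+ b)  ≡⟨ cong (a ℚ.+_) (ℚₚ.+-inverseˡ b) ⟩
      a ℚ.+ 0ℚ             ≡⟨ ℚₚ.+-identityʳ a ⟩
      a                    ∎
      where open ≡-Reasoning

    regroup : ∀ b c e i →
      b ℚ.* (e ℚ.* i) ℚ.+ c ℚ.* (e ℚ.* i) ≡ e ℚ.* (i ℚ.* (b ℚ.+ c))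
    regroup b c e i = begin
      b ℚ.* (e ℚ.* i) ℚ.+ c ℚ.* (e ℚ.* i)  ≡⟨ ℚₚ.*-distribʳ-+ (e ℚ.* i) b c ⟨
      (b ℚ.+ c) ℚ.* (e ℚ.* i)              ≡⟨ ℚₚ.*-comm (b ℚ.+ c) (e ℚ.* i) ⟩
      (e ℚ.* i) ℚ.* (b ℚ.+ c)              ≡⟨ ℚₚ.*-assoc e i (b ℚ.+ c) ⟩
      e ℚ.* (i ℚ.* (b ℚ.+ c))              ∎
      where open ≡-Reasoning

  EventuallyBounded : (ℕ → ℚ) → Set
  EventuallyBounded s =
    ∃[ B ] Positive B × ∃[ N ] (∀ n → N ℕ.≤ n → ∣ s n ∣ ℚ.≤ B)

  cauchy⇒bounded : ∀ s → Cauchy s → EventuallyBounded s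
  cauchy⇒bounded s c with c 1ℚ (positive⁻¹ 1ℚ)
  ... | N , near = 1ℚ ℚ.+ ∣ s N ∣
                 , ℚₚ.pos+nonNeg⇒pos 1ℚ ∣ s N ∣ {{ℚₚ.∣-∣-nonNeg (s N)}}
                 , N , bound
    where
    open ℚₚ.≤-Reasoning
    bound : ∀ n → N ℕ.≤ n → ∣ s n ∣ ℚ.≤ 1ℚ ℚ.+ ∣ s N ∣
    bound n N≤n = begin
      ∣ s n ∣                         ≡⟨ cong ∣_∣ (add-sub (s n) (s N)) ⟨
      ∣ (s n ℚ.- s N) ℚ.+ s N ∣       ≤⟨ ℚₚ.∣p+q∣≤∣p∣+∣q∣ (s n ℚ.- s N) (s N) ⟩
      ∣ s n ℚ.- s N ∣ ℚ.+ ∣ s N ∣     ≤⟨ ℚₚ.+-monoˡ-≤ ∣ s N ∣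
                                           (ℚₚ.<⇒≤ (near n N N≤n ℕₚ.≤-refl)) ⟩
      1ℚ ℚ.+ ∣ s N ∣                  ∎

  const-cauchy : ∀ q → Cauchy (λ _ → q)
  const-cauchy q ε 0<ε = 0 , λ _ _ _ _ →
    subst (ℚ._< ε) (sym (cong ∣_∣ (ℚₚ.+-inverseʳ q))) 0<ε

  +-cauchy : ∀ s t → Cauchy s → Cauchy t → Cauchy (λ n → s n ℚ.+ t n)
  +-cauchy s t cs ct ε 0<ε
    with cs (½ ℚ.* ε) (½-pos 0<ε) | ct (½ ℚ.* ε) (½-pos 0<ε)
  ... | M , nearₛ | N , nearₜ = M ⊔ N , λ m n p q → begin-strict
      ∣ (s m ℚ.+ t m) ℚ.- (s n ℚ.+ t n) ∣
        ≡⟨ cong ∣_∣ (sub-add (s m) (t m) (s n) (t n)) ⟩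
      ∣ (s m ℚ.- s n) ℚ.+ (t m ℚ.- t n) ∣
        ≤⟨ ℚₚ.∣p+q∣≤∣p∣+∣q∣ (s m ℚ.- s n) (t m ℚ.- t n) ⟩
      ∣ s m ℚ.- s n ∣ ℚ.+ ∣ t m ℚ.- t n ∣
        <⟨ ℚₚ.+-mono-< (nearₛ m n (ℕₚ.m⊔n≤o⇒m≤o M N p) (ℕₚ.m⊔n≤o⇒m≤o M N q))
                       (nearₜ m n (ℕₚ.m⊔n≤o⇒n≤o M N p) (ℕₚ.m⊔n≤o⇒n≤o M N q)) ⟩
      ½ ℚ.* ε ℚ.+ ½ ℚ.* ε
        ≡⟨ ½+½ ε ⟩
      ε ∎
    where open ℚₚ.≤-Reasoning

  neg-cauchy : ∀ s → Cauchy s → Cauchy (λ n → ℚ.- s n)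
  neg-cauchy s cs ε 0<ε with cs ε 0<ε
  ... | N , near = N , λ m n p q → subst (ℚ._< ε)
    (sym (trans (cong ∣_∣ (sub-neg (s m) (s n))) (ℚₚ.∣-p∣≡∣p∣ (s m ℚ.- s n))))
    (near m n p q)

  *-cauchy : ∀ s t → Cauchy s → Cauchy t → Cauchy (λ n → s n ℚ.* t n)
  *-cauchy s t cs ct ε 0<ε with cauchy⇒bounded s cs | cauchy⇒bounded t ct
  ... | B , B>0 , K , boundₛ | C , C>0 , L , boundₜ = N , close
    where
    open ℚₚ.≤-Reasoning
    instance
      _ : Positive B
      _ = B>0
      _ : Positive C
      _ = C>0
      _ : Positive ε
      _ = positive 0<ε
      sum>0 : Positive (B ℚ.+ C)
      sum>0 = ℚₚ.pos+pos⇒pos B C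
      sum≢0 : NonZero (B ℚ.+ C)
      sum≢0 = ℚₚ.pos⇒nonZero (B ℚ.+ C)

    δ : ℚ
    δ = ε ℚ.* ℚ.1/ (B ℚ.+ C)

    0<δ : 0ℚ ℚ.< δ
    0<δ = positive⁻¹ δ
      {{ℚₚ.pos*pos⇒pos ε (ℚ.1/ (B ℚ.+ C)) {{ℚₚ.1/pos⇒pos (B ℚ.+ C)}}}}

    M₁ = proj₁ (cs δ 0<δ)
    M₂ = proj₁ (ct δ 0<δ)
    N = (K ⊔ L) ⊔ (M₁ ⊔ M₂)

    mul-< : ∀ {A} a e → Positive A → ∣ a ∣ ℚ.≤ A → ∣ e ∣ ℚ.< δ →
            ∣ a ℚ.* e ∣ ℚ.< A ℚ.* δ
    mul-< {A} a e A>0 a≤A e<δ = begin-strict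
      ∣ a ℚ.* e ∣      ≡⟨ ℚₚ.∣p*q∣≡∣p∣*∣q∣ a e ⟩
      ∣ a ∣ ℚ.* ∣ e ∣  ≤⟨ ℚₚ.*-monoʳ-≤-nonNeg ∣ e ∣ {{ℚₚ.∣-∣-nonNeg e}} a≤A ⟩
      A ℚ.* ∣ e ∣      <⟨ ℚₚ.*-monoʳ-<-pos A {{A>0}} e<δ ⟩
      A ℚ.* δ          ∎

    close : ∀ m n → N ℕ.≤ m → N ℕ.≤ n →
            ∣ s m ℚ.* t m ℚ.- s n ℚ.* t n ∣ ℚ.< ε
    close m n p q = begin-strict
      ∣ s m ℚ.* t m ℚ.- s n ℚ.* t n ∣
        ≡⟨ cong ∣_∣ (sub-mul (s m) (t m) (s n) (t n)) ⟩
      ∣ s m ℚ.* (t m ℚ.- t n) ℚ.+ t n ℚ.* (s m ℚ.- s n) ∣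
        ≤⟨ ℚₚ.∣p+q∣≤∣p∣+∣q∣ (s m ℚ.* (t m ℚ.- t n)) (t n ℚ.* (s m ℚ.- s n)) ⟩
      ∣ s m ℚ.* (t m ℚ.- t n) ∣ ℚ.+ ∣ t n ℚ.* (s m ℚ.- s n) ∣
        <⟨ ℚₚ.+-mono-<
             (mul-< (s m) (t m ℚ.- t n) B>0 (boundₛ m (ℕₚ.m⊔n≤o⇒m≤o K L (left p)))
               (proj₂ (ct δ 0<δ) m n (ℕₚ.m⊔n≤o⇒n≤o M₁ M₂ (right p))
                                     (ℕₚ.m⊔n≤o⇒n≤o M₁ M₂ (right q))))
             (mul-< (t n) (s m ℚ.- s n) C>0 (boundₜ n (ℕₚ.m⊔n≤o⇒n≤o K L (left q)))
               (proj₂ (cs δ 0<δ) m n (ℕₚ.m⊔n≤o⇒m≤o M₁ M₂ (right p))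
                                     (ℕₚ.m⊔n≤o⇒m≤o M₁ M₂ (right q)))) ⟩
      B ℚ.* δ ℚ.+ C ℚ.* δ
        ≡⟨ regroup B C ε (ℚ.1/ (B ℚ.+ C)) ⟩
      ε ℚ.* (ℚ.1/ (B ℚ.+ C) ℚ.* (B ℚ.+ C))
        ≡⟨ cong (ε ℚ.*_) (ℚₚ.*-inverseˡ (B ℚ.+ C)) ⟩
      ε ℚ.* 1ℚ
        ≡⟨ ℚₚ.*-identityʳ ε ⟩
      ε ∎
      where
      left : ∀ {o} → N ℕ.≤ o → K ⊔ L ℕ.≤ o
      left = ℕₚ.m⊔n≤o⇒m≤o (K ⊔ L) (M₁ ⊔ M₂)
      right : ∀ {o} → N ℕ.≤ o → M₁ ⊔ M₂ ℕ.≤ o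
      right = ℕₚ.m⊔n≤o⇒n≤o (K ⊔ L) (M₁ ⊔ M₂)

infixl 6 _+ᵣ_
infixl 7 _*ᵣ_
infix  8 -ᵣ_

0ᵣ 1ᵣ : ℝ
0ᵣ = mkℝ (λ _ → 0ℚ) (const-cauchy 0ℚ)
1ᵣ = mkℝ (λ _ → 1ℚ) (const-cauchy 1ℚ)

_+ᵣ_ _*ᵣ_ : ℝ → ℝ → ℝ
x +ᵣ y = mkℝ (λ n → seq x n ℚ.+ seq y n)
             (+-cauchy (seq x) (seq y) (cauchy x) (cauchy y))
x *ᵣ y = mkℝ (λ n → seq x n ℚ.* seq y n)
             (*-cauchy (seq x) (seq y) (cauchy x) (cauchy y))

-ᵣ_ : ℝ → ℝ
-ᵣ x = mkℝ (λ n → ℚ.- seq x n) (neg-cauchy (seq x) (cauchy x))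

record ℂ : Set where
  constructor _+i_
  field
    re im : ℝ

open ℂ public

ℂ-rawRing : RawRing 0ℓ 0ℓ
ℂ-rawRing = record
  { Carrier = ℂ
  ; _≈_     = λ z w → re z ≈ᵣ re w × im z ≈ᵣ im w
  ; _+_     = λ z w → (re z +ᵣ re w) +i (im z +ᵣ im w)
  ; _*_     = λ z w → (re z *ᵣ re w +ᵣ -ᵣ (im z *ᵣ im w))
                   +i (re z *ᵣ im w +ᵣ im z *ᵣ re w)
  ; -_      = λ z → (-ᵣ re z) +i (-ᵣ im z)
  ; 0#      = 0ᵣ +i 0ᵣ
  ; 1#      = 1ᵣ +i 0ᵣ
  }

open RawRing ℂ-rawRing public
  using (_≈_; _+_; _*_; -_; 0#; 1#)
  renaming (rawSemiring to ℂ-rawSemiring)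

infixl 6 _⊕_

_⊕_ : ∀ {k} → Vec Bool k → Vec Bool k → Vec Bool k
_⊕_ = zipWith _xor_

e : ∀ {k} → Fin k → Vec Bool k
e {k} j = replicate k false [ j ]≔ true

weight : ∀ {k} → Vec Bool k → ℕ
weight = count (Bool._≟ true)

-- `allFin k` lists the positions in increasing order and `filter` preserves
-- it, so these are p₁ < ⋯ < p_l.
differences : ∀ {k} → Vec Bool k → Vec Bool k → List (Fin k)
differences {k} α β =
  filter (λ p → ¬? (lookup α p Bool.≟ lookup β p)) (allFin k)

-- The index i : Fin l counts from 0, hence the exponent suc (toℕ i).
MatchgateIdentities : ∀ {k} → (Vec Bool k → ℂ) → Set
MatchgateIdentities {k} Γ = ∀ (α β : Vec Bool k) →
  let ps = differences α β in
  sum ℂ-rawSemiring (λ (i : Fin (List.length ps)) →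
    let p = List.lookup ps i in
    _^_ ℂ-rawSemiring (- 1#) (suc (toℕ i)) * (Γ (α ⊕ e p) * Γ (β ⊕ e p)))
  ≈ 0#

ParityCondition : ∀ {k} → (Vec Bool k → ℂ) → Set
ParityCondition {k} Γ =
    (∀ (α : Vec Bool k) → ¬ (2 ∣ weight α) → Γ α ≈ 0#)
  ⊎ (∀ (α : Vec Bool k) → 2 ∣ weight α → Γ α ≈ 0#)

{-# OPTIONS --safe #-}

-- Suppose Γ a ≠ 0 and Γ b ≠ 0 with weight a even and weight b odd, and take such
-- a pair at minimal (odd) distance.  In the identity at a ⊕ e p and b ⊕ e p, with
-- p the first position where a and b differ, the first term is − Γ a * Γ b, and
-- every other term has a factor Γ (a ⊕ e p ⊕ e q), which vanishes because
-- a ⊕ e p ⊕ e q has the parity of a and is closer to b.  So Γ a * Γ b = 0, a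
-- contradiction.  That ℂ has no zero divisors follows from the norm and the
-- same fact for ℝ.

module Submission where

open import Defs
open import Level using (0ℓ)
open import Axiom.ExcludedMiddle using (ExcludedMiddle)
open import Data.Bool using (Bool)
open import Data.Nat using (ℕ)
open import Data.Vec using (Vec)

open import Algebra.Bundles.Raw using (RawSemiring)
open import Algebra.Core using (Op₂)
open import Algebra.Definitions.RawSemiring using (sum; _^_)
open import Data.Bool using (true; false; not; _xor_)
import Data.Bool as Bool
import Data.Bool.Properties as Boolₚ
open import Data.Fin using (Fin; zero; suc; toℕ)
open import Data.List as List using (List; []; _∷_; allFin)
open import Data.List.Membership.Propositional using (_∈_)
open import Data.List.Membership.Propositional.Properties
  using (∈-filter⁺; ∈-filter⁻; ∈-allFin; ∈-lookup)
open import Data.List.Properties using (filter-≐)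
import Data.List.Relation.Unary.All as All
import Data.List.Relation.Unary.AllPairs as AllPairs
open import Data.List.Relation.Unary.Any using (here; there)
open import Data.List.Relation.Unary.Unique.Propositional using (Unique)
open import Data.List.Relation.Unary.Unique.Propositional.Properties
  using (filter⁺; allFin⁺)
open import Data.Nat as ℕ using (zero; suc; _⊔_)
open import Data.Nat.Divisibility using (_∣_; _∣0; ∣-refl; ∣m∣n⇒∣m+n; ∣m+n∣m⇒∣n)
import Data.Nat.Properties as ℕₚ
open import Data.Product using (∃-syntax; _×_; _,_; proj₁; proj₂)
open import Data.Rational using (ℚ; 0ℚ; 1ℚ; ½; ∣_∣; Positive; positive; NonNegative)
import Data.Rational as ℚ
import Data.Rational.Properties as ℚₚ
open import Data.Rational.Solver using (module +-*-Solver)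
open import Data.Sum as Sum using (_⊎_; inj₁; inj₂)
open import Data.Vec using ([]; _∷_; lookup; updateAt)
open import Data.Vec.Properties
  using (zipWith-assoc; zipWith-comm; zipWith-identityʳ; lookup-zipWith; lookup∘updateAt′)
open import Function using (_∘_; case_of_)
open import Relation.Binary.Core using (Rel)
open import Relation.Binary.PropositionalEquality
open import Relation.Nullary using (¬_; ¬?; yes; no; contradiction)
open import Relation.Nullary.Decidable using (decidable-stable)

-- Alternating sums with a vanishing tail.

-- Abstract because Agda would otherwise compare complex numbers by unfolding
-- their Cauchy moduli.  The operations are separate parameters so that the
-- instance at ℂ agrees syntactically with the matchgate identities.
module AlternatingSum {c ℓ} (S : RawSemiring c ℓ)
  (_≈_ : Rel (RawSemiring.Carrier S) ℓ) (_*_ : Op₂ (RawSemiring.Carrier S))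
  (0# -1# : RawSemiring.Carrier S)
  (0≈0     : RawSemiring.0# S ≈ 0#)
  (+-≈0    : ∀ x y → x ≈ 0# → y ≈ 0# → RawSemiring._+_ S x y ≈ 0#)
  (+-≈0⁻   : ∀ x y → RawSemiring._+_ S x y ≈ 0# → y ≈ 0# → x ≈ 0#)
  (*-≈0ʳ   : ∀ x y → y ≈ 0# → (x * y) ≈ 0#)
  (neg-≈0⁻ : ∀ x → (_^_ S -1# 1 * x) ≈ 0# → x ≈ 0#)
  where

  open RawSemiring S using () renaming (Carrier to C)

  sum-≈0 : ∀ {n} (f : Fin n → C) → (∀ i → f i ≈ 0#) → sum S f ≈ 0#
  sum-≈0 {zero}  f f≈0 = 0≈0
  sum-≈0 {suc n} f f≈0 =
    +-≈0 (f zero) (sum S (f ∘ suc)) (f≈0 zero) (sum-≈0 (f ∘ suc) (f≈0 ∘ suc))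

  -- The list is a variable `qs` tied to `p ∷ ps` by an equation because a list of differences does
  -- not reduce to a cons. The tail being zero, the sum reduces to its first term, whose sign has
  -- exponent 1.
  alternatingSum-head-≈0 : ∀ {a} {A : Set a} (g : A → C) {p ps qs} → qs ≡ p ∷ ps →
    sum S (λ (i : Fin (List.length qs)) → _^_ S -1# (suc (toℕ i)) * g (List.lookup qs i)) ≈ 0# →
    (∀ {q} → q ∈ ps → g q ≈ 0#) → g p ≈ 0#
  alternatingSum-head-≈0 g {p} {ps} refl sum≈0 tail≈0 =
    neg-≈0⁻ (g p) (+-≈0⁻ (f zero) (sum S (f ∘ suc)) sum≈0
      (sum-≈0 (f ∘ suc) λ i → *-≈0ʳ _ (g (List.lookup ps i)) (tail≈0 (∈-lookup i))))
    where
    f : Fin (suc (List.length ps)) → C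
    f i = _^_ S -1# (suc (toℕ i)) * g (List.lookup (p ∷ ps) i)

-- Null sequences and reals equal to zero.

Null : (ℕ → ℚ) → Set
Null s = ∀ ε → 0ℚ ℚ.< ε → ∃[ N ] (∀ n → N ℕ.≤ n → ∣ s n ∣ ℚ.< ε)

≈0⇒null : ∀ x → x ≈ᵣ 0ᵣ → Null (seq x)
≈0⇒null x x≈0 ε 0<ε with x≈0 ε 0<ε
... | N , small = N , λ n N≤n →
  subst (λ q → ∣ q ∣ ℚ.< ε) (ℚₚ.+-identityʳ (seq x n)) (small n N≤n)

null⇒≈0 : ∀ x → Null (seq x) → x ≈ᵣ 0ᵣ
null⇒≈0 x null ε 0<ε with null ε 0<ε
... | N , small = N , λ n N≤n →
  subst (λ q → ∣ q ∣ ℚ.< ε) (sym (ℚₚ.+-identityʳ (seq x n))) (small n N≤n)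

half-pos : ∀ {ε} → 0ℚ ℚ.< ε → 0ℚ ℚ.< ½ ℚ.* ε
half-pos {ε} 0<ε = ℚₚ.positive⁻¹ _ {{ℚₚ.pos*pos⇒pos ½ ε {{positive 0<ε}}}}

half+half : ∀ ε → ½ ℚ.* ε ℚ.+ ½ ℚ.* ε ≡ ε
half+half = solve 1 (λ e → con ½ :* e :+ con ½ :* e := e) refl
  where open +-*-Solver

+-≈0 : ∀ x y → x ≈ᵣ 0ᵣ → y ≈ᵣ 0ᵣ → x +ᵣ y ≈ᵣ 0ᵣ
+-≈0 x y x≈0 y≈0 = null⇒≈0 (x +ᵣ y) null
  where
  open ℚₚ.≤-Reasoning
  null : Null (seq (x +ᵣ y))
  null ε 0<ε
    with ≈0⇒null x x≈0 (½ ℚ.* ε) (half-pos 0<ε) | ≈0⇒null y y≈0 (½ ℚ.* ε) (half-pos 0<ε)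
  ... | M , smallₓ | N , smallᵧ = M ⊔ N , λ n M⊔N≤n → begin-strict
    ∣ seq x n ℚ.+ seq y n ∣
      ≤⟨ ℚₚ.∣p+q∣≤∣p∣+∣q∣ (seq x n) (seq y n) ⟩
    ∣ seq x n ∣ ℚ.+ ∣ seq y n ∣
      <⟨ ℚₚ.+-mono-< (smallₓ n (ℕₚ.m⊔n≤o⇒m≤o M N M⊔N≤n))
                     (smallᵧ n (ℕₚ.m⊔n≤o⇒n≤o M N M⊔N≤n)) ⟩
    ½ ℚ.* ε ℚ.+ ½ ℚ.* ε
      ≡⟨ half+half ε ⟩
    ε ∎

-- To bring `y` below `ε`, ask `x` for the tolerance `ε` divided by `C`. The bound is required only
-- eventually, because bounds on Cauchy sequences and their distance from zero are available only
-- eventually.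
dominated⇒≈0 : ∀ x y C → Positive C →
  ∃[ N ] (∀ n → N ℕ.≤ n → ∣ seq y n ∣ ℚ.≤ C ℚ.* ∣ seq x n ∣) → x ≈ᵣ 0ᵣ → y ≈ᵣ 0ᵣ
dominated⇒≈0 x y C C>0 (M , dom) x≈0 = null⇒≈0 y null
  where
  open ℚₚ.≤-Reasoning
  instance
    _ : Positive C
    _ = C>0
    C≢0 : ℚ.NonZero C
    C≢0 = ℚₚ.pos⇒nonZero C

  scaled-pos : ∀ {ε} → 0ℚ ℚ.< ε → 0ℚ ℚ.< ℚ.1/ C ℚ.* ε
  scaled-pos {ε} 0<ε = ℚₚ.positive⁻¹ _
    {{ℚₚ.pos*pos⇒pos (ℚ.1/ C) {{ℚₚ.1/pos⇒pos C}} ε {{positive 0<ε}}}}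

  null : Null (seq y)
  null ε 0<ε with ≈0⇒null x x≈0 (ℚ.1/ C ℚ.* ε) (scaled-pos 0<ε)
  ... | N , small = M ⊔ N , λ n M⊔N≤n → begin-strict
    ∣ seq y n ∣            ≤⟨ dom n (ℕₚ.m⊔n≤o⇒m≤o M N M⊔N≤n) ⟩
    C ℚ.* ∣ seq x n ∣      <⟨ ℚₚ.*-monoʳ-<-pos C (small n (ℕₚ.m⊔n≤o⇒n≤o M N M⊔N≤n)) ⟩
    C ℚ.* (ℚ.1/ C ℚ.* ε)   ≡⟨ ℚₚ.*-assoc C (ℚ.1/ C) ε ⟨
    (C ℚ.* ℚ.1/ C) ℚ.* ε   ≡⟨ cong (ℚ._* ε) (ℚₚ.*-inverseʳ C) ⟩
    1ℚ ℚ.* ε               ≡⟨ ℚₚ.*-identityˡ ε ⟩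
    ε                      ∎

∣≤∣⇒≈0 : ∀ x y → (∀ n → ∣ seq y n ∣ ℚ.≤ ∣ seq x n ∣) → x ≈ᵣ 0ᵣ → y ≈ᵣ 0ᵣ
∣≤∣⇒≈0 x y dom = dominated⇒≈0 x y 1ℚ _
  (0 , λ n _ → subst (∣ seq y n ∣ ℚ.≤_) (sym (ℚₚ.*-identityˡ ∣ seq x n ∣)) (dom n))

≈0-resp : ∀ x y → (∀ n → seq x n ≡ seq y n) → x ≈ᵣ 0ᵣ → y ≈ᵣ 0ᵣ
≈0-resp x y x≗y = ∣≤∣⇒≈0 x y λ n → ℚₚ.≤-reflexive (cong ∣_∣ (sym (x≗y n)))

neg-≈0 : ∀ x → x ≈ᵣ 0ᵣ → -ᵣ x ≈ᵣ 0ᵣ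
neg-≈0 x = ∣≤∣⇒≈0 x (-ᵣ x) λ n → ℚₚ.≤-reflexive (ℚₚ.∣-p∣≡∣p∣ (seq x n))

-- A Cauchy sequence is eventually bounded, and a bound for `x` serves as the domination constant.
*-≈0ʳ : ∀ x y → y ≈ᵣ 0ᵣ → x *ᵣ y ≈ᵣ 0ᵣ
*-≈0ʳ x y with cauchy⇒bounded (seq x) (cauchy x)
... | B , B>0 , N , bound = dominated⇒≈0 y (x *ᵣ y) B B>0 (N , dom)
  where
  open ℚₚ.≤-Reasoning
  dom : ∀ n → N ℕ.≤ n → ∣ seq x n ℚ.* seq y n ∣ ℚ.≤ B ℚ.* ∣ seq y n ∣
  dom n N≤n = begin
    ∣ seq x n ℚ.* seq y n ∣      ≡⟨ ℚₚ.∣p*q∣≡∣p∣*∣q∣ (seq x n) (seq y n) ⟩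
    ∣ seq x n ∣ ℚ.* ∣ seq y n ∣  ≤⟨ ℚₚ.*-monoʳ-≤-nonNeg ∣ seq y n ∣
                                      {{ℚₚ.∣-∣-nonNeg (seq y n)}} (bound n N≤n) ⟩
    B ℚ.* ∣ seq y n ∣            ∎

*-≈0ˡ : ∀ x y → x ≈ᵣ 0ᵣ → x *ᵣ y ≈ᵣ 0ᵣ
*-≈0ˡ x y x≈0 =
  ≈0-resp (y *ᵣ x) (x *ᵣ y) (λ n → ℚₚ.*-comm (seq y n) (seq x n)) (*-≈0ʳ y x x≈0)

-- Zero divisors and sums of squares among the reals.

AwayFromZero : ℝ → Set
AwayFromZero x = ∃[ ε ] Positive ε × ∃[ N ] (∀ n → N ℕ.≤ n → ε ℚ.≤ ∣ seq x n ∣)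

-- Past the Cauchy index for half of `ε`, a single term below half of `ε` pulls every later term
-- below `ε`.
≈0⊎away : ExcludedMiddle 0ℓ → ∀ x → x ≈ᵣ 0ᵣ ⊎ AwayFromZero x
≈0⊎away em x with em {AwayFromZero x}
... | yes away = inj₂ away
... | no ¬away = inj₁ (null⇒≈0 x null)
  where
  s = seq x

  split : ∀ p q → p ≡ (p ℚ.- q) ℚ.+ q
  split = solve 2 (λ p q → p := (p :- q) :+ q) refl
    where open +-*-Solver

  null : Null s
  null ε 0<ε with cauchy x (½ ℚ.* ε) (half-pos 0<ε)
  ... | N , near with em {∃[ n ] N ℕ.≤ n × ∣ s n ∣ ℚ.< ½ ℚ.* ε}
  -- Without a small term past `N`, half of `ε` itself bounds the sequence away from zero.
  ...   | no ¬small = contradiction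
            (½ ℚ.* ε , positive (half-pos 0<ε) , N ,
              λ n N≤n → ℚₚ.≮⇒≥ λ small → ¬small (n , N≤n , small))
            ¬away
  ...   | yes (m , N≤m , small) = N , λ n N≤n → begin-strict
            ∣ s n ∣                        ≡⟨ cong ∣_∣ (split (s n) (s m)) ⟩
            ∣ (s n ℚ.- s m) ℚ.+ s m ∣      ≤⟨ ℚₚ.∣p+q∣≤∣p∣+∣q∣ (s n ℚ.- s m) (s m) ⟩
            ∣ s n ℚ.- s m ∣ ℚ.+ ∣ s m ∣    <⟨ ℚₚ.+-mono-< (near n m N≤n N≤m) small ⟩
            ½ ℚ.* ε ℚ.+ ½ ℚ.* ε            ≡⟨ half+half ε ⟩
            ε                              ∎
    where open ℚₚ.≤-Reasoning

-- If the terms of `x` eventually have absolute value at least `ε`, dividing by them costs at most a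
-- factor `ℚ.1/ ε`, so `y` is dominated by the product.
*-≈0⁻ : ExcludedMiddle 0ℓ → ∀ x y → x *ᵣ y ≈ᵣ 0ᵣ → x ≈ᵣ 0ᵣ ⊎ y ≈ᵣ 0ᵣ
*-≈0⁻ em x y xy≈0 with ≈0⊎away em x
... | inj₁ x≈0 = inj₁ x≈0
... | inj₂ (ε , ε>0 , N , away) =
  inj₂ (dominated⇒≈0 (x *ᵣ y) y (ℚ.1/ ε) (ℚₚ.1/pos⇒pos ε) (N , dom) xy≈0)
  where
  open ℚₚ.≤-Reasoning
  instance
    _ : Positive ε
    _ = ε>0
    ε≢0 : ℚ.NonZero ε
    ε≢0 = ℚₚ.pos⇒nonZero ε

  dom : ∀ n → N ℕ.≤ n → ∣ seq y n ∣ ℚ.≤ ℚ.1/ ε ℚ.* ∣ seq x n ℚ.* seq y n ∣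
  dom n N≤n = begin
    ∣ t ∣                            ≡⟨ ℚₚ.*-identityˡ ∣ t ∣ ⟨
    1ℚ ℚ.* ∣ t ∣                     ≡⟨ cong (ℚ._* ∣ t ∣) (ℚₚ.*-inverseˡ ε) ⟨
    (ℚ.1/ ε ℚ.* ε) ℚ.* ∣ t ∣         ≡⟨ ℚₚ.*-assoc (ℚ.1/ ε) ε ∣ t ∣ ⟩
    ℚ.1/ ε ℚ.* (ε ℚ.* ∣ t ∣)         ≤⟨ ℚₚ.*-monoˡ-≤-nonNeg (ℚ.1/ ε)
                                          {{ℚₚ.pos⇒nonNeg (ℚ.1/ ε) {{ℚₚ.1/pos⇒pos ε}}}}
                                          (ℚₚ.*-monoʳ-≤-nonNeg ∣ t ∣ {{ℚₚ.∣-∣-nonNeg t}}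
                                            (away n N≤n)) ⟩
    ℚ.1/ ε ℚ.* (∣ s ∣ ℚ.* ∣ t ∣)     ≡⟨ cong (ℚ.1/ ε ℚ.*_) (ℚₚ.∣p*q∣≡∣p∣*∣q∣ s t) ⟨
    ℚ.1/ ε ℚ.* ∣ s ℚ.* t ∣           ∎
    where
    s = seq x n
    t = seq y n

0≤p*p : ∀ p → 0ℚ ℚ.≤ p ℚ.* p
0≤p*p p = subst (0ℚ ℚ.≤_) (square-∣∣ (ℚₚ.∣p∣≡p∨∣p∣≡-p p))
  (ℚₚ.nonNegative⁻¹ (∣ p ∣ ℚ.* ∣ p ∣)
    {{ℚₚ.nonNeg*nonNeg⇒nonNeg (∣ p ∣) (∣ p ∣)}})
  where
  instance
    _ : NonNegative ∣ p ∣
    _ = ℚₚ.∣-∣-nonNeg p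
  open +-*-Solver
  square-∣∣ : ∣ p ∣ ≡ p ⊎ ∣ p ∣ ≡ ℚ.- p → ∣ p ∣ ℚ.* ∣ p ∣ ≡ p ℚ.* p
  square-∣∣ (inj₁ eq) = cong₂ ℚ._*_ eq eq
  square-∣∣ (inj₂ eq) = trans (cong₂ ℚ._*_ eq eq)
    (solve 1 (λ p → (:- p) :* (:- p) := p :* p) refl p)

-- Squares are nonnegative, so the sum dominates `x *ᵣ x`. The absence of zero divisors then applies
-- to `x` times itself, and both alternatives are the desired conclusion.
sumOfSquares-≈0⁻ : ExcludedMiddle 0ℓ → ∀ x y → x *ᵣ x +ᵣ y *ᵣ y ≈ᵣ 0ᵣ → x ≈ᵣ 0ᵣ
sumOfSquares-≈0⁻ em x y norm≈0 =
  Sum.reduce (*-≈0⁻ em x x (∣≤∣⇒≈0 (x *ᵣ x +ᵣ y *ᵣ y) (x *ᵣ x) dom norm≈0))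
  where
  open ℚₚ.≤-Reasoning
  dom : ∀ n → ∣ seq (x *ᵣ x) n ∣ ℚ.≤ ∣ seq (x *ᵣ x +ᵣ y *ᵣ y) n ∣
  dom n = begin
    ∣ s² ∣          ≡⟨ ℚₚ.0≤p⇒∣p∣≡p 0≤s² ⟩
    s²              ≡⟨ ℚₚ.+-identityʳ s² ⟨
    s² ℚ.+ 0ℚ       ≤⟨ ℚₚ.+-monoʳ-≤ s² 0≤t² ⟩
    s² ℚ.+ t²       ≡⟨ ℚₚ.0≤p⇒∣p∣≡p (ℚₚ.+-mono-≤ 0≤s² 0≤t²) ⟨
    ∣ s² ℚ.+ t² ∣   ∎
    where
    s² t² : ℚ
    s² = seq (x *ᵣ x) n
    t² = seq (y *ᵣ y) n
    0≤s² : 0ℚ ℚ.≤ s²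
    0≤s² = 0≤p*p (seq x n)
    0≤t² : 0ℚ ℚ.≤ t²
    0≤t² = 0≤p*p (seq y n)

-- Vanishing of sums and products of complex numbers.

+-≈0ᶜ : ∀ z w → z ≈ 0# → w ≈ 0# → z + w ≈ 0#
+-≈0ᶜ z w (re-z , im-z) (re-w , im-w) =
  +-≈0 (re z) (re w) re-z re-w , +-≈0 (im z) (im w) im-z im-w

+-≈0ᶜ⁻ : ∀ z w → z + w ≈ 0# → w ≈ 0# → z ≈ 0#
+-≈0ᶜ⁻ z w (re-z+w , im-z+w) (re-w , im-w) =
  cancel (re z) (re w) re-z+w re-w , cancel (im z) (im w) im-z+w im-w
  where
  open +-*-Solver
  cancel : ∀ x y → x +ᵣ y ≈ᵣ 0ᵣ → y ≈ᵣ 0ᵣ → x ≈ᵣ 0ᵣ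
  cancel x y x+y≈0 y≈0 = ≈0-resp (x +ᵣ y +ᵣ -ᵣ y) x
    (λ n → solve 2 (λ p q → (p :+ q) :+ :- q := p) refl (seq x n) (seq y n))
    (+-≈0 (x +ᵣ y) (-ᵣ y) x+y≈0 (neg-≈0 y y≈0))

*-≈0ᶜʳ : ∀ z w → w ≈ 0# → z * w ≈ 0#
*-≈0ᶜʳ z w (re-w , im-w) =
    +-≈0 (re z *ᵣ re w) (-ᵣ (im z *ᵣ im w)) (*-≈0ʳ (re z) (re w) re-w)
      (neg-≈0 (im z *ᵣ im w) (*-≈0ʳ (im z) (im w) im-w))
  , +-≈0 (re z *ᵣ im w) (im z *ᵣ re w) (*-≈0ʳ (re z) (im w) im-w) (*-≈0ʳ (im z) (re w) re-w)

*-≈0ᶜˡ : ∀ z w → z ≈ 0# → z * w ≈ 0#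
*-≈0ᶜˡ z w (re-z , im-z) =
    +-≈0 (re z *ᵣ re w) (-ᵣ (im z *ᵣ im w)) (*-≈0ˡ (re z) (re w) re-z)
      (neg-≈0 (im z *ᵣ im w) (*-≈0ˡ (im z) (im w) im-z))
  , +-≈0 (re z *ᵣ im w) (im z *ᵣ re w) (*-≈0ˡ (re z) (im w) re-z) (*-≈0ˡ (im z) (re w) im-z)

-- The squared modulus `norm` is multiplicative, by the two-square identity applied term by term,
-- and vanishes only at zero. This reduces the claim to the reals.
*-≈0ᶜ⁻ : ExcludedMiddle 0ℓ → ∀ z w → z * w ≈ 0# → z ≈ 0# ⊎ w ≈ 0#
*-≈0ᶜ⁻ em z w (re-zw , im-zw) =
  Sum.map (norm-≈0⁻ z) (norm-≈0⁻ w)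
    (*-≈0⁻ em (norm z) (norm w) (≈0-resp (norm (z * w)) (norm z *ᵣ norm w) norm-* norm-zw≈0))
  where
  open +-*-Solver
  norm : ℂ → ℝ
  norm u = re u *ᵣ re u +ᵣ im u *ᵣ im u

  norm-* : ∀ n → seq (norm (z * w)) n ≡ seq (norm z) n ℚ.* seq (norm w) n
  norm-* n = solve 4
    (λ a b c d →
      (a :* c :+ :- (b :* d)) :* (a :* c :+ :- (b :* d))
        :+ (a :* d :+ b :* c) :* (a :* d :+ b :* c)
      := (a :* a :+ b :* b) :* (c :* c :+ d :* d)) refl
    (seq (re z) n) (seq (im z) n) (seq (re w) n) (seq (im w) n)

  norm-zw≈0 : norm (z * w) ≈ᵣ 0ᵣ
  norm-zw≈0 = +-≈0 (x *ᵣ x) (y *ᵣ y) (*-≈0ˡ x x re-zw) (*-≈0ˡ y y im-zw)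
    where
    x = re (z * w)
    y = im (z * w)

  norm-≈0⁻ : ∀ u → norm u ≈ᵣ 0ᵣ → u ≈ 0#
  norm-≈0⁻ u norm≈0 =
      sumOfSquares-≈0⁻ em (re u) (im u) norm≈0
    , sumOfSquares-≈0⁻ em (im u) (re u)
        (≈0-resp (norm u) (im u *ᵣ im u +ᵣ re u *ᵣ re u)
          (λ n → ℚₚ.+-comm (seq (re u *ᵣ re u) n) (seq (im u *ᵣ im u) n)) norm≈0)

neg-≈0ᶜ⁻ : ∀ w → _^_ ℂ-rawSemiring (- 1#) 1 * w ≈ 0# → w ≈ 0#
neg-≈0ᶜ⁻ w (re-neg , im-neg) =
    ≈0-resp (-ᵣ re -w) (re w) (λ n → re-eq (seq (re w) n) (seq (im w) n)) (neg-≈0 (re -w) re-neg)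
  , ≈0-resp (-ᵣ im -w) (im w) (λ n → im-eq (seq (re w) n) (seq (im w) n)) (neg-≈0 (im -w) im-neg)
  where
  open +-*-Solver
  -w : ℂ
  -w = _^_ ℂ-rawSemiring (- 1#) 1 * w
  -- The parts of `(- 1#) ^ 1` are sequences whose terms compute to `ℚ.- 1ℚ` and `0ℚ`, so the goals
  -- for the terms of `-w` are these rational identities.
  re-eq : ∀ p q → ℚ.- ((ℚ.- 1ℚ) ℚ.* p ℚ.+ ℚ.- (0ℚ ℚ.* q)) ≡ p
  re-eq = solve 2 (λ p q → :- (con (ℚ.- 1ℚ) :* p :+ :- (con 0ℚ :* q)) := p) refl
  im-eq : ∀ p q → ℚ.- ((ℚ.- 1ℚ) ℚ.* q ℚ.+ 0ℚ ℚ.* p) ≡ q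
  im-eq = solve 2 (λ p q → :- (con (ℚ.- 1ℚ) :* q :+ con 0ℚ :* p) := q) refl

0≈0ᶜ : 0# ≈ 0#
0≈0ᶜ = 0≈0 , 0≈0
  where
  0≈0 : 0ᵣ ≈ᵣ 0ᵣ
  0≈0 ε 0<ε = 0 , λ _ _ → 0<ε

-- Bit strings: xor, weight and positions of difference.

⊕-assoc : ∀ {k} (u v w : Vec Bool k) → (u ⊕ v) ⊕ w ≡ u ⊕ (v ⊕ w)
⊕-assoc = zipWith-assoc Boolₚ.xor-assoc

⊕-comm : ∀ {k} (u v : Vec Bool k) → u ⊕ v ≡ v ⊕ u
⊕-comm = zipWith-comm Boolₚ.xor-comm

⊕-cancelʳ : ∀ {k} (u v : Vec Bool k) → (u ⊕ v) ⊕ v ≡ u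
⊕-cancelʳ []      []      = refl
⊕-cancelʳ (x ∷ u) (y ∷ v) = cong₂ _∷_
  (trans (Boolₚ.xor-assoc x y y)
    (trans (cong (x xor_) (Boolₚ.xor-same y)) (Boolₚ.xor-identityʳ x)))
  (⊕-cancelʳ u v)

⊕-swapʳ : ∀ {k} (u v w : Vec Bool k) → (u ⊕ v) ⊕ w ≡ (u ⊕ w) ⊕ v
⊕-swapʳ u v w = trans (⊕-assoc u v w)
  (trans (cong (u ⊕_) (⊕-comm v w)) (sym (⊕-assoc u w v)))

⊕-e : ∀ {k} (v : Vec Bool k) p → v ⊕ e p ≡ updateAt v p not
⊕-e (x ∷ v) zero    = cong₂ _∷_ (Boolₚ.xor-comm x true)
  (zipWith-identityʳ Boolₚ.xor-identityʳ v)
⊕-e (x ∷ v) (suc p) = cong₂ _∷_ (Boolₚ.xor-identityʳ x) (⊕-e v p)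

lookup-⊕-e : ∀ {k} (v : Vec Bool k) {p q} → q ≢ p → lookup (v ⊕ e p) q ≡ lookup v q
lookup-⊕-e v {p} {q} q≢p =
  trans (cong (λ u → lookup u q) (⊕-e v p)) (lookup∘updateAt′ q p q≢p v)

weight-⊕-e : ∀ {k} (v : Vec Bool k) p → lookup v p ≡ true →
             weight v ≡ suc (weight (v ⊕ e p))
weight-⊕-e v p vₚ = trans (weight-clear v p vₚ) (cong (suc ∘ weight) (sym (⊕-e v p)))
  where
  weight-clear : ∀ {k} (v : Vec Bool k) p → lookup v p ≡ true →
                 weight v ≡ suc (weight (updateAt v p not))
  weight-clear (true  ∷ v) zero    _  = refl
  weight-clear (false ∷ v) (suc p) vₚ = weight-clear v p vₚ
  weight-clear (true  ∷ v) (suc p) vₚ = cong suc (weight-clear v p vₚ)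

-- Among `x`, `y` and `x xor y` either none or exactly two are true, so each position contributes 0
-- or 2.
weight-⊕ : ∀ {k} (u v : Vec Bool k) → 2 ∣ weight (u ⊕ v) ℕ.+ (weight u ℕ.+ weight v)
weight-⊕ []          []          = 2 ∣0
weight-⊕ (false ∷ u) (false ∷ v) = weight-⊕ u v
weight-⊕ (true  ∷ u) (true  ∷ v)
  rewrite ℕₚ.+-suc (weight u) (weight v)
        | ℕₚ.+-suc (weight (u ⊕ v)) (suc (weight u ℕ.+ weight v))
        | ℕₚ.+-suc (weight (u ⊕ v)) (weight u ℕ.+ weight v)
  = ∣m∣n⇒∣m+n ∣-refl (weight-⊕ u v)
weight-⊕ (true  ∷ u) (false ∷ v)
  rewrite ℕₚ.+-suc (weight (u ⊕ v)) (weight u ℕ.+ weight v)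
  = ∣m∣n⇒∣m+n ∣-refl (weight-⊕ u v)
weight-⊕ (false ∷ u) (true  ∷ v)
  rewrite ℕₚ.+-suc (weight u) (weight v)
        | ℕₚ.+-suc (weight (u ⊕ v)) (weight u ℕ.+ weight v)
  = ∣m∣n⇒∣m+n ∣-refl (weight-⊕ u v)

odd⇒∃true : ∀ {k} (v : Vec Bool k) → ¬ (2 ∣ weight v) → ∃[ p ] lookup v p ≡ true
odd⇒∃true []          odd = contradiction (2 ∣0) odd
odd⇒∃true (true  ∷ v) odd = zero , refl
odd⇒∃true (false ∷ v) odd with odd⇒∃true v odd
... | p , vₚ = suc p , vₚ

xor≡true⇒≢ : ∀ {x y} → x xor y ≡ true → x ≢ y
xor≡true⇒≢ {x} xor≡true refl = case trans (sym (Boolₚ.xor-same x)) xor≡true of λ ()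

≢⇒xor≡true : ∀ {x y} → x ≢ y → x xor y ≡ true
≢⇒xor≡true {true}  {true}  x≢y = contradiction refl x≢y
≢⇒xor≡true {true}  {false} x≢y = refl
≢⇒xor≡true {false} {true}  x≢y = refl
≢⇒xor≡true {false} {false} x≢y = contradiction refl x≢y

∈-differences⁺ : ∀ {k} (α β : Vec Bool k) {p} → lookup (α ⊕ β) p ≡ true → p ∈ differences α β
∈-differences⁺ α β {p} diff =
  ∈-filter⁺ (λ p → ¬? (lookup α p Bool.≟ lookup β p)) (∈-allFin p)
    (xor≡true⇒≢ (trans (sym (lookup-zipWith _xor_ p α β)) diff))

∈-differences⁻ : ∀ {k} (α β : Vec Bool k) {p} → p ∈ differences α β → lookup (α ⊕ β) p ≡ true
∈-differences⁻ {k} α β {p} p∈ = trans (lookup-zipWith _xor_ p α β)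
  (≢⇒xor≡true (proj₂ (∈-filter⁻ (λ p → ¬? (lookup α p Bool.≟ lookup β p)) {xs = allFin k} p∈)))

-- This keeps the later differences distinct from the first, so that flipping the first and a later
-- one changes two separate positions.
differences-unique : ∀ {k} (α β : Vec Bool k) → Unique (differences α β)
differences-unique {k} α β =
  filter⁺ (λ p → ¬? (lookup α p Bool.≟ lookup β p)) (allFin⁺ k)

-- Xor with a fixed bit is injective, so both filters keep the same positions. Hence the identity at
-- `a ⊕ e p` and `b ⊕ e p` is still indexed by the differences of `a` and `b`.
differences-⊕ : ∀ {k} (α β γ : Vec Bool k) →
  differences (α ⊕ γ) (β ⊕ γ) ≡ differences α β
differences-⊕ {k} α β γ = filter-≐ _ _
  ( (λ {p} ≢ eq → ≢ (begin
      lookup (α ⊕ γ) p           ≡⟨ lookup-zipWith _xor_ p α γ ⟩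
      lookup α p xor lookup γ p  ≡⟨ cong (_xor lookup γ p) eq ⟩
      lookup β p xor lookup γ p  ≡⟨ lookup-zipWith _xor_ p β γ ⟨
      lookup (β ⊕ γ) p           ∎))
  , (λ {p} ≢ eq → ≢ (begin
      lookup α p                       ≡⟨ cong (λ v → lookup v p) (⊕-cancelʳ α γ) ⟨
      lookup ((α ⊕ γ) ⊕ γ) p           ≡⟨ lookup-zipWith _xor_ p (α ⊕ γ) γ ⟩
      lookup (α ⊕ γ) p xor lookup γ p  ≡⟨ cong (_xor lookup γ p) eq ⟩
      lookup (β ⊕ γ) p xor lookup γ p  ≡⟨ lookup-zipWith _xor_ p (β ⊕ γ) γ ⟨
      lookup ((β ⊕ γ) ⊕ γ) p           ≡⟨ cong (λ v → lookup v p) (⊕-cancelʳ β γ) ⟩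
      lookup β p                       ∎)))
  (allFin k)
  where open ≡-Reasoning

-- Induction on odd distance and the split by parity.

-- This replaces the choice of a pair at minimal distance: `b` stays fixed and `n` bounds the
-- distance. Flipping two differing positions of `a` lowers the distance by two, which keeps it odd
-- and so never zero.
odd-distance-induction : ∀ {k} (b : Vec Bool k) (P : Vec Bool k → Set) →
  (∀ a {p ps} → differences a b ≡ p ∷ ps → (∀ {q} → q ∈ ps → P ((a ⊕ e p) ⊕ e q)) → P a) →
  ∀ n a → weight (a ⊕ b) ℕ.≤ n → ¬ (2 ∣ weight (a ⊕ b)) → P a
odd-distance-induction b P step zero a d≤0 odd =
  contradiction (subst (2 ∣_) (sym (ℕₚ.n≤0⇒n≡0 d≤0)) (2 ∣0)) odd
odd-distance-induction b P step (suc n) a d≤1+n odd =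
  by-first-difference (differences a b) refl
    (∈-differences⁺ a b (proj₂ (odd⇒∃true (a ⊕ b) odd)))
  where
  by-first-difference : ∀ ps → differences a b ≡ ps →
    proj₁ (odd⇒∃true (a ⊕ b) odd) ∈ ps → P a
  -- The membership argument rules out the empty list: an odd distance forces some difference.
  by-first-difference (p ∷ ps) diff _ = step a diff tail
    where
    differs : ∀ {q} → q ∈ p ∷ ps → lookup (a ⊕ b) q ≡ true
    differs {q} q∈ = ∈-differences⁻ a b (subst (q ∈_) (sym diff) q∈)

    p∉ps : All.All (p ≢_) ps
    p∉ps = AllPairs.head (subst Unique diff (differences-unique a b))

    tail : ∀ {q} → q ∈ ps → P ((a ⊕ e p) ⊕ e q)
    tail {q} q∈ps = odd-distance-induction b P step n a′
      -- The distance falls by two while the bound falls by one, leaving one to spare.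
      (ℕₚ.≤-trans (ℕₚ.n≤1+n _) (ℕ.s≤s⁻¹ (subst (ℕ._≤ suc n) drop-2 d≤1+n)))
      (λ even → odd (subst (2 ∣_) (sym drop-2) (∣m∣n⇒∣m+n ∣-refl even)))
      where
      open ≡-Reasoning
      a′ = (a ⊕ e p) ⊕ e q

      q≢p : q ≢ p
      q≢p q≡p = All.lookup p∉ps q∈ps (sym q≡p)

      drop-2 : weight (a ⊕ b) ≡ 2 ℕ.+ weight (a′ ⊕ b)
      drop-2 = begin
        weight (a ⊕ b)
          ≡⟨ weight-⊕-e (a ⊕ b) p (differs (here refl)) ⟩
        suc (weight ((a ⊕ b) ⊕ e p))
          ≡⟨ cong suc (weight-⊕-e ((a ⊕ b) ⊕ e p) q
               (trans (lookup-⊕-e (a ⊕ b) q≢p) (differs (there q∈ps)))) ⟩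
        2 ℕ.+ weight (((a ⊕ b) ⊕ e p) ⊕ e q)
          ≡⟨ cong (λ v → 2 ℕ.+ weight (v ⊕ e q)) (⊕-swapʳ a b (e p)) ⟩
        2 ℕ.+ weight (((a ⊕ e p) ⊕ b) ⊕ e q)
          ≡⟨ cong (λ v → 2 ℕ.+ weight v) (⊕-swapʳ (a ⊕ e p) b (e q)) ⟩
        2 ℕ.+ weight (a′ ⊕ b) ∎

-- Either no odd string violates `P`, or one such `b` exists; in the latter case every even string
-- is at odd distance from `b`.
parity-dichotomy : ExcludedMiddle 0ℓ → ∀ {k} (P : Vec Bool k → Set) →
  (∀ a b → ¬ (2 ∣ weight (a ⊕ b)) → ¬ P b → P a) →
  (∀ α → ¬ (2 ∣ weight α) → P α) ⊎ (∀ α → 2 ∣ weight α → P α)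
parity-dichotomy em P separated with em {∃[ b ] ¬ (2 ∣ weight b) × ¬ P b}
... | no ¬odd-support = inj₁ λ α odd → decidable-stable em
  λ ¬Pα → ¬odd-support (α , odd , ¬Pα)
... | yes (b , odd , ¬Pb) = inj₂ λ α even → separated α b
  -- An even distance together with an even `α` would make `b` even by `weight-⊕`.
  (λ even′ → odd (∣m+n∣m⇒∣n (∣m+n∣m⇒∣n (weight-⊕ α b) even′) even)) ¬Pb

-- Consequences of the matchgate identities.

module _ {k} (Γ : Vec Bool k → ℂ) (mgi : MatchgateIdentities Γ) where

  open AlternatingSum ℂ-rawSemiring _≈_ _*_ 0# (- 1#) 0≈0ᶜ +-≈0ᶜ +-≈0ᶜ⁻ *-≈0ᶜʳ neg-≈0ᶜ⁻
    using (alternatingSum-head-≈0)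

  -- The hypothesis concerns only the factors at `α`: one vanishing factor removes each later term,
  -- whatever the factor at `β`.
  leading-term : ∀ α β {p ps} → differences α β ≡ p ∷ ps →
    (∀ {q} → q ∈ ps → Γ (α ⊕ e q) ≈ 0#) → Γ (α ⊕ e p) * Γ (β ⊕ e p) ≈ 0#
  leading-term α β diff tail≈0 =
    alternatingSum-head-≈0 (λ q → Γ (α ⊕ e q) * Γ (β ⊕ e q)) diff (mgi α β)
      λ {q} q∈ps → *-≈0ᶜˡ (Γ (α ⊕ e q)) (Γ (β ⊕ e q)) (tail≈0 q∈ps)

  -- Shifting both strings by `e p` beforehand makes the flip at `p` in the leading term restore `a`
  -- and `b`.
  product-≈0 : ∀ a b {p ps} → differences a b ≡ p ∷ ps →
    (∀ {q} → q ∈ ps → Γ ((a ⊕ e p) ⊕ e q) ≈ 0#) → Γ a * Γ b ≈ 0#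
  product-≈0 a b {p} diff tail≈0 =
    subst₂ (λ α β → Γ α * Γ β ≈ 0#)
      {(a ⊕ e p) ⊕ e p} {a} {(b ⊕ e p) ⊕ e p} {b} (⊕-cancelʳ a (e p)) (⊕-cancelʳ b (e p))
      (leading-term (a ⊕ e p) (b ⊕ e p) (trans (differences-⊕ a b (e p)) diff) tail≈0)

  odd-distance⇒≈0 : ExcludedMiddle 0ℓ → ∀ a b → ¬ (2 ∣ weight (a ⊕ b)) →
    ¬ (Γ b ≈ 0#) → Γ a ≈ 0#
  odd-distance⇒≈0 em a b odd Γb≉0 = odd-distance-induction b (λ a → Γ a ≈ 0#)
    (λ a diff tail≈0 → Sum.fromInj₁ (λ Γb≈0 → contradiction Γb≈0 Γb≉0)
      (*-≈0ᶜ⁻ em (Γ a) (Γ b) (product-≈0 a b diff tail≈0)))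
    (weight (a ⊕ b)) a ℕₚ.≤-refl odd

theorem2 : ExcludedMiddle 0ℓ → ∀ (k : ℕ) (Γ : Vec Bool k → ℂ) → MatchgateIdentities Γ → ParityCondition Γ
theorem2 em k Γ mgi = parity-dichotomy em (λ α → Γ α ≈ 0#) (odd-distance⇒≈0 Γ mgi em)
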